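{- There exists a sequence $(G_n)_{n\in\mathbb{N}}$ of connected graphs such that $|V(G_n)|=n$ for all $n$, $R_2(G_n)=O(n\log n)$ and $R_3(G_n)=\Omega(n\log^2 n)$.
   Context: For a graph $G$ and integer $r\geqslant 2$, the $r$-colour Ramsey number $R_r(G)$ is the smallest integer $N$ such that every colouring of the edges of the complete graph $K_N$ with $r$ colours contains a copy of $G$ all of whose edges have the same colour. -}

module Defs where

open import Data.Fin using (Fin)
open import Data.Nat using (ℕ; _*_; _≤_; NonZero)
open import Data.Product using (Σ-syntax; ∃-syntax; _×_)
open import Function.Definitions using (Injective)
open import Level using (0ℓ)
open import Relation.Binary.Core using (Rel)
open import Relation.Binary.Definitions using (Decidable; Irreflexive; Symmetric)
open import Relation.Binary.Construct.Closure.ReflexiveTransitive using (Star)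
open import Relation.Binary.PropositionalEquality using (_≡_)

-- Finite simple graphs with vertex set Fin n, so |V| = n. Decidability of
-- adjacency is what makes the graph a finite object constructively.
record Graph (n : ℕ) : Set₁ where
  field
    Adj    : Rel (Fin n) 0ℓ
    adj?   : Decidable Adj
    sym    : Symmetric Adj
    irrefl : Irreflexive _≡_ Adj

-- The graph with no vertices is not connected.
Connected : ∀ {n} → Graph n → Set
Connected {n} G = NonZero n × (∀ u v → Star (Graph.Adj G) u v)

-- An edge of K_N is an unordered pair of distinct vertices, so a colouring is
-- a symmetric function; its values on the diagonal are never used.
record EdgeColouring (N r : ℕ) : Set where
  field
    colour     : Fin N → Fin N → Fin r
    colour-sym : ∀ i j → colour i j ≡ colour j i

-- Copies are not necessarily induced.
MonochromaticCopy : ∀ {n N r} → Graph n → EdgeColouring N r → Set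
MonochromaticCopy {n} {N} {r} G χ =
  Σ[ f ∈ (Fin n → Fin N) ] Injective _≡_ _≡_ f ×
  (∃[ c ] ∀ u v → Graph.Adj G u v → EdgeColouring.colour χ (f u) (f v) ≡ c)

Arrows : ∀ {n} → ℕ → ℕ → Graph n → Set
Arrows N r G = (χ : EdgeColouring N r) → MonochromaticCopy G χ

-- N = R_r(G), the least N such that every r-colouring of K_N contains a
-- monochromatic copy of G. Stated as a relation because totality of R_r is
-- Ramsey's theorem.
IsRamseyNumber : ∀ {n} → ℕ → Graph n → ℕ → Set
IsRamseyNumber r G N = Arrows N r G × (∀ M → Arrows M r G → N ≤ M)

-- For ℕ-valued functions the constant may be taken to be a natural number.
infix 4 _=O_ _=Ω_

_=O_ : (f g : ℕ → ℕ) → Set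
f =O g = ∃[ C ] ∃[ n₀ ] ∀ n → n₀ ≤ n → f n ≤ C * g n

-- f ≥ (1 / C) g eventually, for some positive integer C.
_=Ω_ : (f g : ℕ → ℕ) → Set
f =Ω g = ∃[ C ] NonZero C × (∃[ n₀ ] ∀ n → n₀ ≤ n → g n ≤ C * f n)

{-# OPTIONS --safe #-}

-- Take for G the clique K_{k+1}, with k = ⌊½ log₂ n⌋, one of whose vertices,
-- the centre, is joined to all n − k − 1 remaining vertices.
--
-- Three colours: split k²(n − 1) vertices into classes (a, b) ∈ [k]² of size
-- n − 1, and give an edge the second colour if the a's differ, else the third
-- if the b's differ, else the first. The second and third colours contain no
-- K_{k+1}, and the first has components of size n − 1 < n.
--
-- Two colours: it suffices to find a monochromatic K_{k+1} with a vertex of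
-- degree at least n in that colour. Let m be about n log n and N = 3m + 1. If
-- more than m vertices have degree ≥ n in both colours, then Ramsey's theorem
-- gives such a clique among them, since 2^{2k+1} ≤ m. Otherwise more than m
-- vertices have degree < n in the same colour c; as m ≥ (k + 1) n they contain,
-- greedily, a clique avoiding c, whose vertices have large degree in the other
-- colour.

module Submission where

open import Data.Fin as Fin using (Fin; zero; suc; toℕ; fromℕ<; inject≤; opposite; remQuot; combine; finToFun; funToFin)
import Data.Fin.Properties as Fin
open import Data.List using (List; []; _∷_; _++_; length; filter; lookup; map; allFin)
import Data.List.Properties as List
open import Data.List.Membership.Propositional using (_∈_)
open import Data.List.Membership.Propositional.Properties using (∈-allFin; ∈-filter⁺; ∈-filter⁻; ∈-lookup)
import Data.List.Membership.DecPropositional as DecMembership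
import Data.List.Relation.Binary.Sublist.Propositional as Sublist
import Data.List.Relation.Binary.Sublist.Propositional.Properties as Sublist
open import Data.List.Relation.Unary.All as All using (All; []; _∷_)
import Data.List.Relation.Unary.All.Properties as All
open import Data.List.Relation.Unary.AllPairs as AllPairs using (AllPairs; []; _∷_)
import Data.List.Relation.Unary.AllPairs.Properties as AllPairs
open import Data.List.Relation.Unary.Any using (here; there; index)
open import Data.List.Relation.Unary.Any.Properties using (lookup-index)
open import Data.List.Relation.Unary.Unique.Propositional using (Unique)
import Data.List.Relation.Unary.Unique.Propositional.Properties as Unique
open import Data.Nat using (ℕ; zero; suc; pred; _+_; _*_; _∸_; _^_; _≤_; _<_; z≤n; s≤s; _≤?_; _<?_; ⌊_/2⌋; ⌈_/2⌉; NonZero; >-nonZero; >-nonZero⁻¹)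
open import Data.Nat.Induction using (<-rec)
open import Data.Nat.Logarithm using (⌊log₂_⌋; ⌊log₂⌋-mono-≤; ⌊log₂⌊n/2⌋⌋≡⌊log₂n⌋∸1)
open import Data.Nat.Properties
open import Data.Nat.Tactic.RingSolver using (solve-∀)
open import Data.Product using (Σ-syntax; ∃-syntax; ∃; _×_; _,_; proj₁; proj₂; uncurry; map₂)
open import Data.Sum using (_⊎_; inj₁; inj₂; swap)
open import Function using (_∘_; id; _⇔_; mk⇔; Equivalence)
open import Function.Definitions using (Injective)
open import Level using (Level)
open import Relation.Binary.Construct.Closure.ReflexiveTransitive using (Star; ε; _◅_)
open import Relation.Binary.Core using (Rel)
open import Relation.Binary.Definitions using (DecidableEquality; Symmetric; _Respects_)
open import Relation.Binary.PropositionalEquality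
open import Relation.Nullary using (¬_; Dec; yes; no; contradiction; ¬?)
open import Relation.Nullary.Decidable using (map′; _×-dec_; _⊎-dec_; _→-dec_)
open import Relation.Unary using (Pred; Decidable)
open import Defs

private
  variable
    a p : Level
    A : Set a
    n N r : ℕ

-- Least witnesses, the pigeonhole principle and lists without repetition.

least : {P : ℕ → Set p} → Decidable P → ∀ n → P n → ∃[ m ] P m × (∀ j → P j → m ≤ j)
least P? n Pn with P? 0
least P? n       Pn | yes P0 = 0 , P0 , λ _ _ → z≤n
least P? zero    Pn | no ¬P0 = contradiction Pn ¬P0
least P? (suc n) Pn | no ¬P0 with least (P? ∘ suc) n Pn
... | m , Pm , least-m = suc m , Pm , λ where
  zero    P0 → contradiction P0 ¬P0
  (suc j) Pj → s≤s (least-m j Pj)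

module _ {P : Pred A p} (P? : Decidable P) where

  length-filter-¬? : ∀ xs → length (filter P? xs) + length (filter (¬? ∘ P?) xs) ≡ length xs
  length-filter-¬? []       = refl
  length-filter-¬? (x ∷ xs) with P? x
  ... | yes _ = cong suc (length-filter-¬? xs)
  ... | no  _ = trans (+-suc _ _) (cong suc (length-filter-¬? xs))

module _ {C : Set} (_≟_ : DecidableEquality C) (f : A → C) where

  fibre : C → List A → List A
  fibre c = filter (λ x → f x ≟ c)

  -- Induction on `cs`: the fibre of one value is split off, and the remaining entries take values
  -- in the shorter list, their fibres being sublists of the old ones.
  length-≤-fibres : ∀ b cs xs → All (λ x → f x ∈ cs) xs → (∀ c → length (fibre c xs) ≤ b) →
                    length xs ≤ length cs * b
  length-≤-fibres b []       []       _        _    = z≤n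
  length-≤-fibres b []       (x ∷ xs) (() ∷ _) _
  length-≤-fibres b (c ∷ cs) xs       f∈       fib≤ = begin
    length xs                        ≡⟨ length-filter-¬? (λ x → f x ≟ c) xs ⟨
    length (fibre c xs) + length ys  ≤⟨ +-mono-≤ (fib≤ c) (length-≤-fibres b cs ys f∈cs fibys≤) ⟩
    b + length cs * b                ∎
    where
    open ≤-Reasoning
    ≢c? : Decidable (λ x → f x ≢ c)
    ≢c? x = ¬? (f x ≟ c)
    ys = filter ≢c? xs
    f∈cs : All (λ x → f x ∈ cs) ys
    f∈cs = All.zipWith (λ where (here eq , ≢c) → contradiction eq ≢c
                                (there ∈cs , _) → ∈cs)
                       (All.filter⁺ ≢c? f∈ , All.all-filter ≢c? xs)
    fibys≤ : ∀ d → length (fibre d ys) ≤ b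
    fibys≤ d = ≤-trans
      (Sublist.length-mono-≤ (Sublist.filter⁺ (λ x → f x ≟ d) (λ x → f x ≟ d) (λ { refl → id })
                               (Sublist.filter-⊆ ≢c? xs)))
      (fib≤ d)

pigeonhole-fibre : ∀ {m} (f : A → Fin m) b xs → m * b < length xs →
                   ∃[ c ] b < length (fibre Fin._≟_ f c xs)
pigeonhole-fibre {m = m} f b xs mb<xs with Fin.any? (λ c → b <? length (fibre Fin._≟_ f c xs))
... | yes big = big
... | no ¬big = contradiction mb<xs (≤⇒≯ (begin
  length xs              ≤⟨ length-≤-fibres Fin._≟_ f b (allFin m) xs
                              (All.universal (λ x → ∈-allFin (f x)) xs)
                              (λ c → ≮⇒≥ (λ b< → ¬big (c , b<))) ⟩
  length (allFin m) * b  ≡⟨ cong (_* b) (List.length-tabulate {n = m} id) ⟩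
  m * b                  ∎))
  where open ≤-Reasoning

lookup-AllPairs : ∀ {ℓ} {R : Rel A ℓ} → Symmetric R → ∀ {xs} → AllPairs R xs →
                  ∀ {i j} → i ≢ j → R (lookup xs i) (lookup xs j)
lookup-AllPairs R-sym (_ ∷ _)   {zero}  {zero}  i≢j = contradiction refl i≢j
lookup-AllPairs R-sym (Rx ∷ _)  {zero}  {suc j} i≢j = All.lookup Rx (∈-lookup j)
lookup-AllPairs R-sym (Rx ∷ _)  {suc i} {zero}  i≢j = R-sym (All.lookup Rx (∈-lookup i))
lookup-AllPairs R-sym (_ ∷ Rxs) {suc i} {suc j} i≢j = lookup-AllPairs R-sym Rxs (i≢j ∘ cong suc)

lookup-Unique : {xs : List A} → Unique xs → Injective _≡_ _≡_ (lookup xs)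
lookup-Unique xs! {i} {j} eq with i Fin.≟ j
... | yes i≡j = i≡j
... | no  i≢j = contradiction eq (lookup-AllPairs ≢-sym xs! i≢j)

lookup-++-< : ∀ (xs {ys} : List A) (i : Fin (length (xs ++ ys))) (i< : toℕ i < length xs) →
              lookup (xs ++ ys) i ≡ lookup xs (fromℕ< i<)
lookup-++-< (x ∷ xs) zero    i<       = refl
lookup-++-< (x ∷ xs) (suc i) (s≤s i<) = lookup-++-< xs i i<

-- Sending a position in `xs` to a position of the same entry in `ys` is injective, as `xs` has no
-- repetitions.
Unique-length-≤ : {xs ys : List A} → Unique xs → All (_∈ ys) xs → length xs ≤ length ys
Unique-length-≤ {xs = xs} {ys} xs! xs⊆ys = Fin.injective⇒≤ {f = position} position-injective
  where
  mem : ∀ i → lookup xs i ∈ ys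
  mem i = All.lookup xs⊆ys (∈-lookup i)
  position : Fin (length xs) → Fin (length ys)
  position i = index (mem i)
  position-injective : Injective _≡_ _≡_ position
  position-injective {i} {j} eq = lookup-Unique xs!
    (trans (lookup-index (mem i)) (trans (cong (lookup ys) eq) (sym (lookup-index (mem j)))))

-- Monochromatic cliques, and cliques avoiding a colour.

module _ (χ : EdgeColouring N r) where
  open EdgeColouring χ

  Edge : Fin r → Rel (Fin N) _
  Edge c u v = u ≢ v × colour u v ≡ c

  Edge-sym : ∀ {c} → Symmetric (Edge c)
  Edge-sym (u≢v , eq) = ≢-sym u≢v , trans (colour-sym _ _) eq

  -- The diagonal value is counted too, so v itself may occur in this list.
  neighbours : Fin r → Fin N → List (Fin N)
  neighbours c v = fibre Fin._≟_ (colour v) c (allFin N)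

  -- Each vertex is paired with the colour of all its edges to later vertices.
  prehomogeneous : 2 ≤ r → ∀ l xs → Unique xs → r ^ l ≤ length xs →
    ∃[ ps ] length ps ≡ l × All (λ p → proj₁ p ∈ xs) ps ×
            AllPairs (λ p q → Edge (proj₂ p) (proj₁ p) (proj₁ q)) ps
  prehomogeneous 2≤r zero    xs _ _ = [] , refl , [] , []
  prehomogeneous 2≤r (suc l) []       _   big = contradiction big (<⇒≱ (m^n>0 r (suc l)))
    where instance _ = >-nonZero (≤-trans (s≤s z≤n) 2≤r)
  prehomogeneous 2≤r (suc l) (v ∷ xs) (v∉ ∷ xs!) big =
    let c , many = pigeonhole-fibre (colour v) (pred (r ^ l)) xs room
        ofColour-c? = λ u → colour v u Fin.≟ c
        ps , len , ps∈ , hom = prehomogeneous 2≤r l (filter ofColour-c? xs)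
          (Unique.filter⁺ ofColour-c? xs!) (subst (_≤ length (filter ofColour-c? xs)) (suc-pred (r ^ l)) many)
    in (v , c) ∷ ps , cong suc len
       , here refl ∷ All.map (there ∘ proj₁ ∘ ∈-filter⁻ ofColour-c?) ps∈
       , All.map (λ u∈ → let u∈xs , eq = ∈-filter⁻ ofColour-c? {xs = xs} u∈
                         in All.lookup v∉ u∈xs , eq) ps∈
         ∷ hom
    where
    instance
      _ = >-nonZero (≤-trans (s≤s z≤n) 2≤r)
      _ = m^n≢0 r l
    -- A colour class of size `r ^ l` is wanted among the vertices after `v`. Since `r` is at least
    -- 2, the loss of `v` still leaves at least `r ^ suc l - 1` vertices, more than
    -- `r * (r ^ l - 1)`.
    room : r * pred (r ^ l) < length xs
    room = ≤-pred (begin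
      2 + r * pred (r ^ l)    ≤⟨ +-monoˡ-≤ _ 2≤r ⟩
      r + r * pred (r ^ l)    ≡⟨ *-suc r _ ⟨
      r * suc (pred (r ^ l))  ≡⟨ cong (r *_) (suc-pred (r ^ l)) ⟩
      r ^ suc l               ≤⟨ big ⟩
      suc (length xs)         ∎)
      where open ≤-Reasoning

  -- Of `r * k + 1` prehomogeneous vertices more than `k` carry the same colour; these form a clique
  -- in it, since an edge takes the colour of its earlier end.
  ramsey : 2 ≤ r → ∀ k xs → Unique xs → r ^ suc (r * k) ≤ length xs →
           ∃[ c ] ∃[ q ] k < length q × All (_∈ xs) q × AllPairs (Edge c) q
  ramsey 2≤r k xs xs! big =
    let ps , len , ps∈ , hom = prehomogeneous 2≤r (suc (r * k)) xs xs! big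
        c , many = pigeonhole-fibre proj₂ k ps (≤-reflexive (sym len))
        c? = λ p → proj₂ p Fin.≟ c
    in c , map proj₁ (filter c? ps)
       , subst (k <_) (sym (List.length-map proj₁ (filter c? ps))) many
       , All.map⁺ (All.filter⁺ c? ps∈)
       , AllPairs.map⁺ (same-colour (All.all-filter c? ps) (AllPairs.filter⁺ c? hom))
    where
    same-colour : ∀ {c qs} → All (λ p → proj₂ p ≡ c) qs →
                  AllPairs (λ p q → Edge (proj₂ p) (proj₁ p) (proj₁ q)) qs →
                  AllPairs (λ p q → Edge c (proj₁ p) (proj₁ q)) qs
    same-colour []          []          = []
    same-colour (refl ∷ cs) (es ∷ hom′) = es ∷ same-colour cs hom′

  -- Greedy choice: keep the first vertex `v` and discard its neighbours of colour `c`. Together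
  -- with `v` this uses up at most `d` entries, the degree bound being strict, so `j * d` entries
  -- allow `j` choices.
  clique-avoiding : ∀ c d .{{_ : NonZero d}} j xs → Unique xs → All (λ v → length (neighbours c v) < d) xs →
                    j * d ≤ length xs →
                    ∃[ q ] j ≤ length q × All (_∈ xs) q ×
                           AllPairs (λ u v → u ≢ v × colour u v ≢ c) q
  clique-avoiding c d zero    xs _ _ _ = [] , z≤n , [] , []
  clique-avoiding c d (suc j) []       _ _ big =
    contradiction (≤-trans (m≤m+n d (j * d)) big) (<⇒≱ (>-nonZero⁻¹ d))
  clique-avoiding c d (suc j) (v ∷ xs) (v∉ ∷ xs!) (v-poor ∷ poor) big =
    let q , len , q∈ , q-avoids =
          clique-avoiding c d j ys (Unique.filter⁺ ≢c? xs!) (All.filter⁺ ≢c? poor) room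
    in v ∷ q , s≤s len
       , here refl ∷ All.map (there ∘ proj₁ ∘ ∈-filter⁻ ≢c?) q∈
       , All.map (λ u∈ → let u∈xs , ≢c = ∈-filter⁻ ≢c? {xs = xs} u∈
                         in All.lookup v∉ u∈xs , ≢c) q∈
         ∷ q-avoids
    where
    c? = λ u → colour v u Fin.≟ c
    ≢c? : Decidable (λ u → colour v u ≢ c)
    ≢c? = ¬? ∘ c?
    ys = filter ≢c? xs
    removed : length (filter c? xs) ≤ length (neighbours c v)
    removed = Unique-length-≤ (Unique.filter⁺ c? xs!)
      (All.map (λ eq → ∈-filter⁺ c? (∈-allFin _) eq) (All.all-filter c? xs))
    room : j * d ≤ length ys
    room = +-cancelˡ-≤ d _ _ (begin
      d + j * d                                 ≤⟨ big ⟩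
      suc (length xs)                           ≡⟨ cong suc (length-filter-¬? c? xs) ⟨
      suc (length (filter c? xs)) + length ys   ≤⟨ +-monoˡ-≤ _ (≤-trans (s≤s removed) v-poor) ⟩
      d + length ys                             ∎)
      where open ≤-Reasoning

-- Decidability of `Arrows` and existence of Ramsey numbers.

-- Functions are coded by numbers below `n ^ m`. Decoding returns a function only pointwise equal to
-- the original, hence the condition that `P` respects `_≗_`.
∃-function? : ∀ {m n} {P : Pred (Fin m → Fin n) p} → P Respects _≗_ → Decidable P → Dec (∃ P)
∃-function? P-resp P? = map′
  (λ (i , Pi) → finToFun i , Pi)
  (λ (f , Pf) → funToFin f , P-resp (sym ∘ Fin.finToFun-funToFin f) Pf)
  (Fin.any? (P? ∘ finToFun))

module _ (G : Graph n) where
  open Graph G using (Adj; adj?; irrefl)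

  -- A monochromatic clique on more than `n` vertices contains every graph on `n` vertices. This
  -- crude bound serves to make the search for the least arrowing number finite.
  Arrows-clique : 2 ≤ r → Arrows (r ^ suc (r * n)) r G
  Arrows-clique {r} 2≤r χ =
    let c , q , n<q , _ , mono = ramsey χ 2≤r n (allFin _) (Unique.allFin⁺ _)
                                   (≤-reflexive (sym (List.length-tabulate id)))
        n≤q = <⇒≤ n<q
        into = λ i → inject≤ i n≤q
    in lookup q ∘ into
     , Fin.inject≤-injective n≤q n≤q _ _ ∘ lookup-Unique (AllPairs.map proj₁ mono)
     , c , λ u v u~v → proj₂ (lookup-AllPairs (Edge-sym χ) mono
             (λ eq → irrefl (Fin.inject≤-injective n≤q n≤q u v eq) u~v))

  monochromaticCopy? : Decidable (MonochromaticCopy {N = N} {r} G)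
  monochromaticCopy? χ = ∃-function?
    (λ {f} {g} f≗g (f-inj , c , mono) →
        (λ {u} {v} eq → f-inj (trans (f≗g u) (trans eq (sym (f≗g v)))))
      , c , λ u v u~v → trans (sym (cong₂ colour (f≗g u) (f≗g v))) (mono u v u~v))
    (λ f → map′ (λ inj {u} {v} → inj u v) (λ inj u v → inj {u} {v})
             (Fin.all? λ u → Fin.all? λ v → (f u Fin.≟ f v) →-dec (u Fin.≟ v))
           ×-dec Fin.any? λ c → Fin.all? λ u → Fin.all? λ v →
             adj? u v →-dec (colour (f u) (f v) Fin.≟ c))
    where open EdgeColouring χ

  MonochromaticCopy-resp : {χ χ′ : EdgeColouring N r} →
    (∀ i j → EdgeColouring.colour χ i j ≡ EdgeColouring.colour χ′ i j) →
    MonochromaticCopy G χ → MonochromaticCopy G χ′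
  MonochromaticCopy-resp χ≗χ′ (f , f-inj , c , mono) =
    f , f-inj , c , λ u v u~v → trans (sym (χ≗χ′ (f u) (f v))) (mono u v u~v)

  -- A colouring is coded, row by row, by a number below `(r ^ N) ^ N`, so a finite search decides.
  -- Codes that are not symmetric pass vacuously, and a copy in the decoded colouring is carried
  -- over to the given one, which agrees with it pointwise.
  arrows? : ∀ N → Dec (Arrows N r G)
  arrows? {r} N = map′ every (λ arrows i symm → arrows (colouring i symm)) (Fin.all? λ i → check i)
    where
    decode : Fin ((r ^ N) ^ N) → Fin N → Fin N → Fin r
    decode i u v = finToFun (finToFun {r ^ N} {N} i u) v
    encode : (Fin N → Fin N → Fin r) → Fin ((r ^ N) ^ N)
    encode f = funToFin (funToFin ∘ f)
    decode-encode : ∀ f u v → decode (encode f) u v ≡ f u v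
    decode-encode f u v = trans
      (cong (λ i → finToFun i v) (Fin.finToFun-funToFin (funToFin ∘ f) u))
      (Fin.finToFun-funToFin (f u) v)
    SymmetricCode : Fin ((r ^ N) ^ N) → Set
    SymmetricCode i = ∀ u v → decode i u v ≡ decode i v u
    colouring : ∀ i → SymmetricCode i → EdgeColouring N r
    colouring i symm = record { colour = decode i ; colour-sym = symm }
    check : ∀ i → Dec (∀ symm → MonochromaticCopy G (colouring i symm))
    check i with Fin.all? (λ u → Fin.all? λ v → decode i u v Fin.≟ decode i v u)
    ... | no ¬symm = yes (λ symm → contradiction symm ¬symm)
    -- A copy mentions only the colours, so one copy serves for every proof of symmetry.
    ... | yes symm = map′ (λ copy _ → copy) (λ copy → copy symm) (monochromaticCopy? (colouring i symm))
    every : (∀ i symm → MonochromaticCopy G (colouring i symm)) → Arrows N r G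
    every copies χ = MonochromaticCopy-resp {χ = colouring _ symm} {χ} (decode-encode colour) (copies _ symm)
      where
      open EdgeColouring χ
      symm : SymmetricCode (encode colour)
      symm u v = trans (decode-encode colour u v) (trans (colour-sym u v) (sym (decode-encode colour v u)))

  ramseyNumber : 2 ≤ r → ∃ (IsRamseyNumber r G)
  ramseyNumber {r} 2≤r = least arrows? (r ^ suc (r * n)) (Arrows-clique 2≤r)

-- The graph: a clique inside a spanning star.

cliqueStar : ∀ n → ℕ → Graph n
cliqueStar n k = record
  { Adj    = λ u v → u ≢ v × (InClique u × InClique v ⊎ IsCentre u ⊎ IsCentre v)
  ; adj?   = λ u v → ¬? (u Fin.≟ v) ×-dec
                     ((inClique? u ×-dec inClique? v) ⊎-dec (isCentre? u ⊎-dec isCentre? v))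
  ; sym    = λ where
      (u≢v , inj₁ (u∈ , v∈)) → ≢-sym u≢v , inj₁ (v∈ , u∈)
      (u≢v , inj₂ centre)    → ≢-sym u≢v , inj₂ (swap centre)
  ; irrefl = λ u≡v u~v → proj₁ u~v u≡v
  }
  where
  InClique IsCentre : Fin n → Set
  InClique u = toℕ u ≤ k
  IsCentre u = toℕ u ≡ 0
  inClique? : Decidable InClique
  inClique? u = toℕ u ≤? k
  isCentre? : Decidable IsCentre
  isCentre? u = toℕ u ≟ 0

cliqueStar-connected : ∀ n k → .{{NonZero n}} → Connected (cliqueStar n k)
cliqueStar-connected (suc n) k = _ , λ u v → to-centre u v (u Fin.≟ zero) (v Fin.≟ zero)
  where
  to-centre : ∀ u v → Dec (u ≡ zero) → Dec (v ≡ zero) → Star (Graph.Adj (cliqueStar (suc n) k)) u v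
  to-centre u v (yes refl) (yes refl) = ε
  to-centre u v (yes refl) (no v≢0)   = (≢-sym v≢0 , inj₂ (inj₁ refl)) ◅ ε
  to-centre u v (no u≢0)   (yes refl) = (u≢0 , inj₂ (inj₂ refl)) ◅ ε
  to-centre u v (no u≢0)   (no v≢0)   =
    (u≢0 , inj₂ (inj₂ refl)) ◅ (≢-sym v≢0 , inj₂ (inj₁ refl)) ◅ ε

-- Two colours: the upper bound.

module _ (χ : EdgeColouring N r) where
  open EdgeColouring χ
  open DecMembership (Fin._≟_ {N}) using (_∈?_)

  -- Vertex `i` goes to entry `i` of `vs`, which lists the clique, led by the centre `v`, and then
  -- the other neighbours of `v` in colour `c`.
  cliqueStar-copy : ∀ {n k c q} → k < length q → AllPairs (Edge χ c) q →
    All (λ v → n ≤ length (neighbours χ c v)) q → MonochromaticCopy (cliqueStar n k) χ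
  cliqueStar-copy {n} {k} {c} {v ∷ q} k<q clique@(v~q ∷ _) (n≤deg ∷ _) =
    lookup vs ∘ into , into-injective ∘ lookup-Unique vs! , c , mono
    where
    inQ? = _∈? (v ∷ q)
    -- Dropping the clique members keeps `vs` free of repetitions; this also drops `v`, which may be
    -- listed as its own neighbour.
    leaves = filter (¬? ∘ inQ?) (neighbours χ c v)
    vs = (v ∷ q) ++ leaves
    neighbours! : Unique (neighbours χ c v)
    neighbours! = Unique.filter⁺ _ (Unique.allFin⁺ N)
    vs! : Unique vs
    vs! = Unique.++⁺ (AllPairs.map proj₁ clique) (Unique.filter⁺ _ neighbours!)
      (λ (∈q , ∈leaves) → proj₂ (∈-filter⁻ (¬? ∘ inQ?) {xs = neighbours χ c v} ∈leaves) ∈q)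
    -- At most `length (v ∷ q)` neighbours were dropped, and the clique put in front makes up for
    -- them.
    n≤vs : n ≤ length vs
    n≤vs = begin
      n                              ≤⟨ n≤deg ⟩
      length (neighbours χ c v)      ≡⟨ length-filter-¬? inQ? (neighbours χ c v) ⟨
      length (filter inQ? (neighbours χ c v)) + length leaves
        ≤⟨ +-monoˡ-≤ _ (Unique-length-≤ (Unique.filter⁺ inQ? neighbours!) (All.all-filter inQ? (neighbours χ c v))) ⟩
      length (v ∷ q) + length leaves ≡⟨ List.length-++ (v ∷ q) ⟨
      length vs                      ∎
      where open ≤-Reasoning
    into : Fin n → Fin (length vs)
    into u = inject≤ u n≤vs
    into-injective : Injective _≡_ _≡_ into
    into-injective = Fin.inject≤-injective n≤vs n≤vs _ _
    centre : ∀ i j → i ≢ j → toℕ i ≡ 0 → colour (lookup vs i) (lookup vs j) ≡ c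
    centre zero zero    0≢0 _ = contradiction refl 0≢0
    -- Entry 0 is `v`; a later entry is a clique member or a leaf, and either way joined to `v` in
    -- colour `c`.
    centre zero (suc j) _   _ = All.lookup
      (All.++⁺ (All.map proj₂ v~q)
               (All.filter⁺ (¬? ∘ inQ?) (All.all-filter (λ u → colour v u Fin.≟ c) (allFin N))))
      (∈-lookup j)
    inside : ∀ i j → i ≢ j → toℕ i ≤ k → toℕ j ≤ k → colour (lookup vs i) (lookup vs j) ≡ c
    inside i j i≢j i≤k j≤k = trans
      (cong₂ colour (lookup-++-< (v ∷ q) i i<) (lookup-++-< (v ∷ q) j j<))
      (proj₂ (lookup-AllPairs (Edge-sym χ) clique
               (i≢j ∘ Fin.toℕ-injective ∘ Fin.fromℕ<-injective _ _ i< j<)))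
      where
      i< = ≤-<-trans i≤k k<q
      j< = ≤-<-trans j≤k k<q
    mono : ∀ u w → Graph.Adj (cliqueStar n k) u w → colour (lookup vs (into u)) (lookup vs (into w)) ≡ c
    -- `inject≤` keeps indices, so the index conditions in `adj` become conditions on positions in
    -- `vs`.
    mono u w (u≢w , adj) with toℕ u | Fin.toℕ-inject≤ u n≤vs | toℕ w | Fin.toℕ-inject≤ w n≤vs
    mono u w (u≢w , inj₁ (u≤k , w≤k))  | _ | refl | _ | refl = inside _ _ (u≢w ∘ into-injective) u≤k w≤k
    mono u w (u≢w , inj₂ (inj₁ u≡0))   | _ | refl | _ | _    = centre _ _ (u≢w ∘ into-injective) u≡0
    mono u w (u≢w , inj₂ (inj₂ w≡0))   | _ | _    | _ | refl =
      trans (colour-sym _ _) (centre _ _ (≢-sym u≢w ∘ into-injective) w≡0)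

≢⇒≡opposite : {b c : Fin 2} → b ≢ c → b ≡ opposite c
≢⇒≡opposite {zero}     {zero}     b≢c = contradiction refl b≢c
≢⇒≡opposite {zero}     {suc zero} _   = refl
≢⇒≡opposite {suc zero} {zero}     _   = refl
≢⇒≡opposite {suc zero} {suc zero} b≢c = contradiction refl b≢c

cliqueStar-Arrows₂ : ∀ n k m .{{_ : NonZero n}} → 2 ^ suc (2 * k) ≤ m → suc k * n ≤ m →
                     Arrows (suc (3 * m)) 2 (cliqueStar n k)
cliqueStar-Arrows₂ n k m pow≤m kn≤m χ =
  let l , many = pigeonhole-fibre label m (allFin M) (≤-reflexive (sym (List.length-tabulate {n = M} id)))
  in cases l many
  where
  open EdgeColouring χ
  M = suc (3 * m)
  Poor : Fin M → Fin 2 → Set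
  Poor v c = length (neighbours χ c v) < n
  poor? : ∀ v → Dec (∃ (Poor v))
  poor? v = Fin.any? (λ c → length (neighbours χ c v) <? n)
  -- Label 0 marks large degree in both colours, label `suc c` a chosen colour `c` of degree below
  -- `n`. Among `3 * m + 1` vertices one of the three labels occurs more than `m` times.
  label : Fin M → Fin 3
  label v with poor? v
  ... | yes (c , _) = suc c
  ... | no  _       = zero
  label-zero : ∀ {v} → label v ≡ zero → ∀ c → n ≤ length (neighbours χ c v)
  label-zero {v} eq c with poor? v
  label-zero () c | yes _
  ... | no ¬poor = ≮⇒≥ (λ poor → ¬poor (c , poor))
  label-suc : ∀ {v c} → label v ≡ suc c → Poor v c
  label-suc {v} eq with poor? v
  label-suc refl | yes (c , poor) = poor
  label-suc ()   | no _
  n≤m : n ≤ m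
  n≤m = ≤-trans (m≤m+n n (k * n)) kn≤m
  -- The counts for the two colours, diagonal included, add up to `M`, which exceeds `2 * n`; they
  -- cannot both be below `n`.
  poor⇒opposite-rich : ∀ {v c} → Poor v c → n ≤ length (neighbours χ (opposite c) v)
  poor⇒opposite-rich {v} {c} poor = +-cancelˡ-≤ n _ _ (begin
    n + n                                         ≤⟨ +-mono-≤ n≤m n≤m ⟩
    m + m                                         ≤⟨ +-monoʳ-≤ m (m≤m+n m (m + 0)) ⟩
    3 * m                                         ≤⟨ n≤1+n _ ⟩
    M                                             ≡⟨ List.length-tabulate {n = M} id ⟨
    length (allFin M)                             ≡⟨ length-filter-¬? c? (allFin M) ⟨
    length (neighbours χ c v) + length (filter (¬? ∘ c?) (allFin M))
      ≤⟨ +-mono-≤ (<⇒≤ poor) (Unique-length-≤ (Unique.filter⁺ (¬? ∘ c?) (Unique.allFin⁺ M))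
           (All.map (λ ≢c → ∈-filter⁺ (λ u → colour v u Fin.≟ opposite c) (∈-allFin _) (≢⇒≡opposite ≢c))
                    (All.all-filter (¬? ∘ c?) (allFin M)))) ⟩
    n + length (neighbours χ (opposite c) v)      ∎)
    where
    open ≤-Reasoning
    c? = λ u → colour v u Fin.≟ c
  cases : ∀ l → m < length (fibre Fin._≟_ label l (allFin M)) → MonochromaticCopy (cliqueStar n k) χ
  cases zero many =
    let c , q , k<q , q∈ , clique = ramsey χ (s≤s (s≤s z≤n)) k _
          (Unique.filter⁺ (λ v → label v Fin.≟ zero) (Unique.allFin⁺ M)) (≤-trans pow≤m (<⇒≤ many))
    in cliqueStar-copy χ k<q clique
         (All.map (λ v∈ → label-zero (proj₂ (∈-filter⁻ (λ v → label v Fin.≟ zero) {xs = allFin M} v∈)) c) q∈)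
  cases (suc c) many =
    let c? = λ v → label v Fin.≟ suc c
        q , k<q , q∈ , avoids = clique-avoiding χ c n (suc k) _
          (Unique.filter⁺ c? (Unique.allFin⁺ M))
          (All.map label-suc (All.all-filter c? (allFin M))) (≤-trans kn≤m (<⇒≤ many))
    -- With two colours, avoiding `c` means having colour `opposite c`.
    in cliqueStar-copy χ k<q (AllPairs.map (map₂ ≢⇒≡opposite) avoids)
         (All.map (λ v∈ → poor⇒opposite-rich (label-suc (proj₂ (∈-filter⁻ c? {xs = allFin M} v∈)))) q∈)

-- Three colours: the lower bound.

firstDifference : {A B : Set} → Dec A → Dec B → Fin 3
firstDifference (no _)  _       = suc zero
firstDifference (yes _) (no _)  = suc (suc zero)
firstDifference (yes _) (yes _) = zero

module _ {A B : Set} where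

  -- The colour depends only on whether each of `A` and `B` holds. For equalities between labels
  -- this makes the colouring symmetric.
  firstDifference-cong : {A′ B′ : Set} → A ⇔ A′ → B ⇔ B′ →
    ∀ (a? : Dec A) (b? : Dec B) (a′? : Dec A′) (b′? : Dec B′) →
    firstDifference a? b? ≡ firstDifference a′? b′?
  firstDifference-cong A⇔ B⇔ (no _)  _       (no _)  _       = refl
  firstDifference-cong A⇔ B⇔ (no ¬a) _       (yes a) _       = contradiction (Equivalence.from A⇔ a) ¬a
  firstDifference-cong A⇔ B⇔ (yes a) _       (no ¬a) _       = contradiction (Equivalence.to A⇔ a) ¬a
  firstDifference-cong A⇔ B⇔ (yes _) (no _)  (yes _) (no _)  = refl
  firstDifference-cong A⇔ B⇔ (yes _) (no ¬b) (yes _) (yes b) = contradiction (Equivalence.from B⇔ b) ¬b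
  firstDifference-cong A⇔ B⇔ (yes _) (yes b) (yes _) (no ¬b) = contradiction (Equivalence.to B⇔ b) ¬b
  firstDifference-cong A⇔ B⇔ (yes _) (yes _) (yes _) (yes _) = refl

  firstDifference≡0 : ∀ (a? : Dec A) (b? : Dec B) → firstDifference a? b? ≡ zero → A × B
  firstDifference≡0 (yes a) (yes b) _ = a , b

  firstDifference≡1 : ∀ (a? : Dec A) (b? : Dec B) → firstDifference a? b? ≡ suc zero → ¬ A
  firstDifference≡1 (no ¬a)  _       _ = ¬a
  firstDifference≡1 (yes _) (no _)  ()
  firstDifference≡1 (yes _) (yes _) ()

  firstDifference≡2 : ∀ (a? : Dec A) (b? : Dec B) → firstDifference a? b? ≡ suc (suc zero) → ¬ B
  firstDifference≡2 (yes _) (no ¬b) _ = ¬b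

module _ {M k n} (label : Fin M → Fin k × Fin k × Fin n) where

  private
    first second : Fin M → Fin k
    first  = proj₁ ∘ label
    second = proj₁ ∘ proj₂ ∘ label
    first? : ∀ x y → Dec (first x ≡ first y)
    first? x y = first x Fin.≟ first y
    second? : ∀ x y → Dec (second x ≡ second y)
    second? x y = second x Fin.≟ second y

  productColouring : EdgeColouring M 3
  productColouring = record
    { colour     = λ x y → firstDifference (first? x y) (second? x y)
    ; colour-sym = λ x y → firstDifference-cong (mk⇔ sym sym) (mk⇔ sym sym)
                             (first? x y) (second? x y) (first? y x) (second? y x)
    }

  -- Injectivity of `label` limits each class, the vertices sharing `first` and `second`, to `n`
  -- members, one fewer than the graph has. The condition `k ≤ n` makes room in the graph for all
  -- `k + 1` clique vertices.
  productColouring-avoids : Injective _≡_ _≡_ label → k ≤ n →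
                            ¬ MonochromaticCopy (cliqueStar (suc n) k) productColouring
  productColouring-avoids label-inj k≤n (f , f-inj , c , mono) = avoids c mono
    where
    _~_ = Graph.Adj (cliqueStar (suc n) k)
    K : Fin (suc k) → Fin (suc n)
    K i = inject≤ i (s≤s k≤n)
    -- In colours 1 and 2 one coordinate separates adjacent vertices, so it would map the `k + 1`
    -- clique vertices injectively into `Fin k`.
    no-clique : (g : Fin M → Fin k) → ¬ (∀ u v → u ~ v → g (f u) ≢ g (f v))
    no-clique g distinct = Fin.<⇒notInjective {f = g ∘ f ∘ K} (n<1+n k) injective
      where
      inK : ∀ i → toℕ (K i) ≤ k
      inK i = subst (_≤ k) (sym (Fin.toℕ-inject≤ i (s≤s k≤n))) (Fin.toℕ≤pred[n] i)
      injective : Injective _≡_ _≡_ (g ∘ f ∘ K)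
      injective {i} {j} eq with i Fin.≟ j
      ... | yes i≡j = i≡j
      ... | no  i≢j = contradiction eq (distinct (K i) (K j)
              (i≢j ∘ Fin.inject≤-injective (s≤s k≤n) (s≤s k≤n) i j , inj₁ (inK i , inK j)))
    avoids : ∀ c → ¬ (∀ u v → u ~ v → EdgeColouring.colour productColouring (f u) (f v) ≡ c)
    avoids (suc zero)       mono = no-clique first
      (λ u v u~v → firstDifference≡1 (first? (f u) (f v)) (second? (f u) (f v)) (mono u v u~v))
    avoids (suc (suc zero)) mono = no-clique second
      (λ u v u~v → firstDifference≡2 (first? (f u) (f v)) (second? (f u) (f v)) (mono u v u~v))
    -- In colour 0 every vertex is in the class of the centre, being equal or adjacent to it. The
    -- third coordinate would then separate `suc n` vertices within `Fin n`.
    avoids zero             mono = Fin.<⇒notInjective {f = proj₂ ∘ proj₂ ∘ label ∘ f} (n<1+n n) injective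
      where
      like-centre : ∀ v → first (f zero) ≡ first (f v) × second (f zero) ≡ second (f v)
      like-centre v with zero Fin.≟ v
      ... | yes refl = refl , refl
      ... | no  0≢v  = firstDifference≡0 (first? _ _) (second? _ _) (mono zero v (0≢v , inj₂ (inj₁ refl)))
      injective : Injective _≡_ _≡_ (proj₂ ∘ proj₂ ∘ label ∘ f)
      injective {u} {v} eq = f-inj (label-inj (cong₂ _,_
        (trans (sym (proj₁ (like-centre u))) (proj₁ (like-centre v)))
        (cong₂ _,_ (trans (sym (proj₂ (like-centre u))) (proj₂ (like-centre v))) eq)))

remQuot-injective : ∀ {m} n → Injective _≡_ _≡_ (remQuot {m} n)
remQuot-injective {m} n {i} {j} eq =
  trans (sym (Fin.combine-remQuot {m} n i)) (trans (cong (uncurry combine) eq) (Fin.combine-remQuot {m} n j))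

-- `Fin M` embeds in `Fin (k * (k * n))`, whose elements split into three coordinates. Treating
-- every such `M` makes the contrapositive a lower bound on all arrowing numbers.
cliqueStar-¬Arrows₃ : ∀ n k M → k ≤ n → M ≤ k * (k * n) → ¬ Arrows M 3 (cliqueStar (suc n) k)
cliqueStar-¬Arrows₃ n k M k≤n M≤ arrows =
  productColouring-avoids label label-injective k≤n (arrows (productColouring label))
  where
  label : Fin M → Fin k × Fin k × Fin n
  label x = map₂ (remQuot n) (remQuot (k * n) (inject≤ x M≤))
  label-injective : Injective _≡_ _≡_ label
  label-injective {x} {y} eq = Fin.inject≤-injective M≤ M≤ x y (remQuot-injective {k} (k * n)
    (cong₂ _,_ (cong proj₁ eq) (remQuot-injective {k} n (cong proj₂ eq))))

-- Logarithms, choice of parameters and asymptotics.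

2*⌊n/2⌋≤n : ∀ n → 2 * ⌊ n /2⌋ ≤ n
2*⌊n/2⌋≤n n = begin
  2 * ⌊ n /2⌋            ≡⟨ cong (⌊ n /2⌋ +_) (+-identityʳ _) ⟩
  ⌊ n /2⌋ + ⌊ n /2⌋      ≤⟨ +-monoʳ-≤ ⌊ n /2⌋ (⌊n/2⌋≤⌈n/2⌉ n) ⟩
  ⌊ n /2⌋ + ⌈ n /2⌉      ≡⟨ ⌊n/2⌋+⌈n/2⌉≡n n ⟩
  n                      ∎
  where open ≤-Reasoning

-- Here `n` is at most `2 * h + 1`, and `h` is at least 1. Applied to the logarithm, this bounds it
-- by a multiple of the clique parameter.
2≤n⇒n≤3*⌊n/2⌋ : ∀ {n} → 2 ≤ n → n ≤ 3 * ⌊ n /2⌋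
2≤n⇒n≤3*⌊n/2⌋ {n} 2≤n = begin
  n                                ≡⟨ ⌊n/2⌋+⌈n/2⌉≡n n ⟨
  h + ⌈ n /2⌉                      ≤⟨ +-monoʳ-≤ h (⌈n/2⌉≤1+⌊n/2⌋ n) ⟩
  h + (1 + h)                      ≤⟨ +-monoʳ-≤ h (+-monoˡ-≤ h (⌊n/2⌋-mono 2≤n)) ⟩
  h + (h + h)                      ≡⟨ cong (λ x → h + (h + x)) (+-identityʳ h) ⟨
  3 * h                            ∎
  where
  open ≤-Reasoning
  h = ⌊ n /2⌋
  ⌈n/2⌉≤1+⌊n/2⌋ : ∀ n → ⌈ n /2⌉ ≤ 1 + ⌊ n /2⌋
  ⌈n/2⌉≤1+⌊n/2⌋ zero          = z≤n
  ⌈n/2⌉≤1+⌊n/2⌋ (suc zero)    = s≤s z≤n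
  ⌈n/2⌉≤1+⌊n/2⌋ (suc (suc n)) = s≤s (⌈n/2⌉≤1+⌊n/2⌋ n)

-- Strong induction through `⌊ n /2⌋`, whose logarithm is smaller by one.
2^⌊log₂n⌋≤n : ∀ n .{{_ : NonZero n}} → 2 ^ ⌊log₂ n ⌋ ≤ n
2^⌊log₂n⌋≤n (suc n) = <-rec (λ n → NonZero n → 2 ^ ⌊log₂ n ⌋ ≤ n) step (suc n) _
  where
  step : ∀ n → (∀ {m} → m < n → NonZero m → 2 ^ ⌊log₂ m ⌋ ≤ m) → NonZero n → 2 ^ ⌊log₂ n ⌋ ≤ n
  step 1             _   _ = s≤s z≤n
  step n@(suc (suc n-2)) rec _ = begin
    -- The truncated subtraction is exact, the logarithm being at least 1 here.
    2 ^ ⌊log₂ n ⌋              ≡⟨ cong (2 ^_) (m+[n∸m]≡n {1} (⌊log₂⌋-mono-≤ {2} {n} (s≤s (s≤s z≤n)))) ⟨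
    2 * 2 ^ (⌊log₂ n ⌋ ∸ 1)    ≡⟨ cong (λ l → 2 * 2 ^ l) (⌊log₂⌊n/2⌋⌋≡⌊log₂n⌋∸1 n) ⟨
    2 * 2 ^ ⌊log₂ ⌊ n /2⌋ ⌋    ≤⟨ *-monoʳ-≤ 2 (rec (⌊n/2⌋<n (suc n-2)) _) ⟩
    2 * ⌊ n /2⌋                ≤⟨ 2*⌊n/2⌋≤n n ⟩
    n                          ∎
    where open ≤-Reasoning

-- Halving the logarithm gives `2 ^ (2 * k) ≤ n`, which keeps the Ramsey bound linear in `n`, while
-- `k` stays of order `log n`.
cliqueBound : ℕ → ℕ
cliqueBound n = ⌊ ⌊log₂ n ⌋ /2⌋

logCliqueStar : ∀ n → Graph n
logCliqueStar n = cliqueStar n (cliqueBound n)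

-- The factor 2 in `m = 2 * (n * L)` serves both requirements: `2 ^ suc (2 * k)` is at most `2 * n`,
-- and `suc k` is at most `2 * L` because `L` is at least 1.
logCliqueStar-Arrows₂ : ∀ n → 2 ≤ n → Arrows (suc (3 * (2 * (n * ⌊log₂ n ⌋)))) 2 (logCliqueStar n)
logCliqueStar-Arrows₂ n 2≤n = cliqueStar-Arrows₂ n k (2 * (n * L)) pow≤ kn≤
  where
  open ≤-Reasoning
  instance _ = >-nonZero (≤-trans (s≤s z≤n) 2≤n)
  L = ⌊log₂ n ⌋
  k = cliqueBound n
  1≤L : 1 ≤ L
  1≤L = ⌊log₂⌋-mono-≤ 2≤n
  pow≤ : 2 ^ suc (2 * k) ≤ 2 * (n * L)
  pow≤ = *-monoʳ-≤ 2 (begin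
    2 ^ (2 * k)  ≤⟨ ^-monoʳ-≤ 2 (2*⌊n/2⌋≤n L) ⟩
    2 ^ L        ≤⟨ 2^⌊log₂n⌋≤n n ⟩
    n            ≡⟨ *-identityʳ n ⟨
    n * 1        ≤⟨ *-monoʳ-≤ n 1≤L ⟩
    n * L        ∎)
  kn≤ : suc k * n ≤ 2 * (n * L)
  kn≤ = begin
    suc k * n      ≤⟨ *-monoˡ-≤ n (+-mono-≤ 1≤L (⌊n/2⌋≤n L)) ⟩
    (L + L) * n    ≡⟨ rearrange L n ⟩
    2 * (n * L)    ∎
    where
    rearrange : ∀ l n → (l + l) * n ≡ 2 * (n * l)
    rearrange = solve-∀

-- The constant is `2 * 3 ^ 2`: a factor 2 from `suc n ≤ n + n`, and a squared 3 from `L ≤ 3 * k`,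
-- for which at least 4 vertices ensure `2 ≤ L`.
logCliqueStar-Arrows₃⇒≤ : ∀ n R → 4 ≤ n → Arrows R 3 (logCliqueStar n) → n * ⌊log₂ n ⌋ ^ 2 ≤ 18 * R
logCliqueStar-Arrows₃⇒≤ (suc n) R 4≤n arrows = begin
  suc n * L ^ 2                  ≤⟨ *-mono-≤ (+-monoˡ-≤ n 1≤n) (^-monoˡ-≤ 2 (2≤n⇒n≤3*⌊n/2⌋ 2≤L)) ⟩
  (n + n) * (3 * k) ^ 2          ≡⟨ rearrange n k ⟩
  18 * (k * (k * n))             ≤⟨ *-monoʳ-≤ 18 (≰⇒≥ (λ R≤ → cliqueStar-¬Arrows₃ n k R k≤n R≤ arrows)) ⟩
  18 * R                         ∎
  where
  open ≤-Reasoning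
  L = ⌊log₂ suc n ⌋
  k = cliqueBound (suc n)
  1≤n : 1 ≤ n
  1≤n = ≤-trans (s≤s z≤n) (≤-pred 4≤n)
  2≤L : 2 ≤ L
  2≤L = ⌊log₂⌋-mono-≤ 4≤n
  k≤n : k ≤ n
  k≤n = ≤-pred (begin
    suc k                ≤⟨ s≤s (⌊n/2⌋≤n L) ⟩
    suc L                ≤⟨ n<2^n L ⟩
    2 ^ L                ≤⟨ 2^⌊log₂n⌋≤n (suc n) ⟩
    suc n                ∎)
    where
    n<2^n : ∀ n → n < 2 ^ n
    n<2^n zero    = s≤s z≤n
    n<2^n (suc n) = +-mono-≤ (m^n>0 2 n) (≤-trans (n<2^n n) (m≤m+n _ 0))
  rearrange : ∀ n k → (n + n) * ((3 * k) * ((3 * k) * 1)) ≡ 18 * (k * (k * n))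
  rearrange = solve-∀

theorem1p4 : Σ[ G ∈ ((n : ℕ) → Graph n) ]
    (∀ n → NonZero n → Connected (G n)) ×
    (Σ[ R₂ ∈ (ℕ → ℕ) ] Σ[ R₃ ∈ (ℕ → ℕ) ]
    (∀ n → IsRamseyNumber 2 (G n) (R₂ n)) ×
    (∀ n → IsRamseyNumber 3 (G n) (R₃ n)) ×
    (R₂ =O (λ n → n * ⌊log₂ n ⌋)) ×
    (R₃ =Ω (λ n → n * ⌊log₂ n ⌋ ^ 2)))
theorem1p4 =
    logCliqueStar
  , (λ n n≢0 → cliqueStar-connected n (cliqueBound n) {{n≢0}})
  , (λ n → proj₁ (R₂ n)) , (λ n → proj₁ (R₃ n))
  , (λ n → proj₂ (R₂ n)) , (λ n → proj₂ (R₃ n))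
  , (7 , 2 , upper)
  , (18 , _ , 4 , λ n 4≤n → logCliqueStar-Arrows₃⇒≤ n (proj₁ (R₃ n)) 4≤n (proj₁ (proj₂ (R₃ n))))
  where
  R₂ : ∀ n → ∃ (IsRamseyNumber 2 (logCliqueStar n))
  R₂ n = ramseyNumber (logCliqueStar n) (s≤s (s≤s z≤n))
  R₃ : ∀ n → ∃ (IsRamseyNumber 3 (logCliqueStar n))
  R₃ n = ramseyNumber (logCliqueStar n) (s≤s (s≤s z≤n))
  upper : ∀ n → 2 ≤ n → proj₁ (R₂ n) ≤ 7 * (n * ⌊log₂ n ⌋)
  upper n 2≤n = begin
    proj₁ (R₂ n)                            ≤⟨ proj₂ (proj₂ (R₂ n)) _ (logCliqueStar-Arrows₂ n 2≤n) ⟩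
    -- The summand 1 is absorbed by one more copy of `n * ⌊log₂ n ⌋`, which is positive from `n = 2`
    -- on; so 6 becomes 7.
    1 + 3 * (2 * (n * ⌊log₂ n ⌋))           ≤⟨ +-monoˡ-≤ _ (*-mono-≤ (≤-trans (s≤s z≤n) 2≤n) (⌊log₂⌋-mono-≤ 2≤n)) ⟩
    n * ⌊log₂ n ⌋ + 3 * (2 * (n * ⌊log₂ n ⌋)) ≡⟨ cong (n * ⌊log₂ n ⌋ +_) (*-assoc 3 2 (n * ⌊log₂ n ⌋)) ⟨
    7 * (n * ⌊log₂ n ⌋)                     ∎
    where open ≤-Reasoning
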